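{- The frame property of symmetry is definable in $\mathcal{L}(\blacktriangle)$; that is, there is a set $\Gamma\subseteq\mathcal{L}(\blacktriangle)$ such that for every frame $\mathcal{F}=\langle S,R\rangle$, $R$ is symmetric iff $\mathcal{F}\vDash\Gamma$.
   Context: Let $\mathbf{P}$ be a nonempty set of propositional variables. $\mathcal{L}(\blacktriangle)$-formulas: $\varphi::=\top\mid p\mid\neg\varphi\mid(\varphi\land\varphi)\mid\blacktriangle\varphi$ with $p\in\mathbf{P}$. A frame is $\mathcal{F}=\langle S,R\rangle$ with $S$ nonempty and $R\subseteq S\times S$; a model based on $\mathcal{F}$ is $\mathcal{M}=\langle S,R,V\rangle$ with $V:\mathbf{P}\to\mathcal{P}(S)$. Truth: $\top$, variables, $\neg,\land$ as usual; $\mathcal{M},s\vDash\blacktriangle\varphi$ iff (if $\mathcal{M},s\vDash\varphi$ then $\mathcal{M},t\vDash\varphi$ for all $t$ with $sRt$) and (if $\mathcal{M},s\nvDash\varphi$ then $\mathcal{M},t\nvDash\varphi$ for all $t$ with $sRt$). $\mathcal{F}\vDash\varphi$ means $\mathcal{M},s\vDash\varphi$ for every model $\mathcal{M}$ based on $\mathcal{F}$ and every $s\in S$; $\mathcal{F}\vDash\Gamma$ means $\mathcal{F}\vDash\varphi$ for all $\varphi\in\Gamma$. -}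

module Defs where

open import Level using (Level; suc)
open import Data.Product using (_×_)
open import Data.Unit.Polymorphic using (⊤)
open import Relation.Binary.Core using (Rel)
open import Relation.Nullary.Negation using (¬_)
open import Relation.Unary using (Pred; _∈_)

infixr 6 _∧′_
infix  7 ¬′_ ▲_

data Formula {ℓ} (P : Set ℓ) : Set ℓ where
  ⊤′   : Formula P
  var  : P → Formula P
  ¬′_  : Formula P → Formula P
  _∧′_ : Formula P → Formula P → Formula P
  ▲_   : Formula P → Formula P

record Frame (ℓ : Level) : Set (suc ℓ) where
  field
    S        : Set ℓ
    R        : Rel S ℓ
    nonempty : S

Valuation : ∀ {ℓ} → Set ℓ → Frame ℓ → Set (suc ℓ)
Valuation {ℓ} P F = P → Pred (Frame.S F) ℓ

record Model {ℓ} (P : Set ℓ) : Set (suc ℓ) where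
  constructor ⟨_,_⟩
  field
    frame : Frame ℓ
    V     : Valuation P frame
  open Frame frame public

infix 4 _,_⊨_ _⊨ᶠ_ _⊨ˢ_

_,_⊨_ : ∀ {ℓ} {P : Set ℓ} (M : Model P) → Model.S M → Formula P → Set ℓ
M , s ⊨ ⊤′     = ⊤
M , s ⊨ var p  = s ∈ Model.V M p
M , s ⊨ ¬′ φ   = ¬ (M , s ⊨ φ)
M , s ⊨ φ ∧′ ψ = (M , s ⊨ φ) × (M , s ⊨ ψ)
M , s ⊨ ▲ φ    =
    (M , s ⊨ φ → ∀ t → Model.R M s t → M , t ⊨ φ)
  × (¬ (M , s ⊨ φ) → ∀ t → Model.R M s t → ¬ (M , t ⊨ φ))

_⊨ᶠ_ : ∀ {ℓ} {P : Set ℓ} → Frame ℓ → Formula P → Set (suc ℓ)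
_⊨ᶠ_ {P = P} F φ = ∀ (V : Valuation P F) (s : Frame.S F) → ⟨ F , V ⟩ , s ⊨ φ

_⊨ˢ_ : ∀ {ℓ} {P : Set ℓ} → Frame ℓ → Pred (Formula P) ℓ → Set (suc ℓ)
F ⊨ˢ Γ = ∀ φ → φ ∈ Γ → F ⊨ᶠ φ

-- Under φ, ▲ φ amounts to □ φ; hence ¬ p → ▲ ¬ (p ∧ ▲ p) is a rendering of the
-- axiom B for ¬ p. It fails at s when s R t but not t R s, with p true
-- exactly off s.
module Submission where

open import Axiom.ExcludedMiddle using (ExcludedMiddle)
open import Data.Product using (Σ-syntax; _,_; proj₁)
open import Function.Bundles using (_⇔_; mk⇔)
open import Relation.Binary.Definitions using (Symmetric)
open import Relation.Binary.PropositionalEquality using (_≡_; _≢_; refl)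
open import Relation.Nullary.Decidable using (decidable-stable)
open import Relation.Nullary.Negation using (contradiction)
open import Relation.Unary using (Pred)
open import Defs

-- One formula suffices. If `p` fails at s, no successor t satisfies p ∧ ▲ p: by symmetry t R s, so
-- ▲ p would carry `p` from t back to s. Conversely, an edge without its reverse refutes the
-- formula.

infixr 5 _⇒′_

_⇒′_ : ∀ {ℓ} {P : Set ℓ} → Formula P → Formula P → Formula P
φ ⇒′ ψ = ¬′ (φ ∧′ ¬′ ψ)

symAxiom : ∀ {ℓ} {P : Set ℓ} → P → Formula P
symAxiom p = ¬′ var p ⇒′ ▲ ¬′ (var p ∧′ ▲ var p)

symmetric⇒symAxiom : ∀ {ℓ} {P : Set ℓ} (F : Frame ℓ) (p : P) →
  Symmetric (Frame.R F) → F ⊨ᶠ symAxiom p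
symmetric⇒symAxiom F p R-sym V s (¬ps , ¬▲) = ¬▲
  ( (λ _ t sRt (pt , ▲pt) → ¬ps (proj₁ ▲pt pt s (R-sym sRt)))
  -- Vacuous clause: `p` fails at s, so ¬ (p ∧ ▲ p) already holds there.
  , (λ ¬¬ps∧▲ps → contradiction (λ (ps , _) → ¬ps ps) ¬¬ps∧▲ps)
  )

symAxiom⇒symmetric : ∀ {ℓ} {P : Set ℓ} → ExcludedMiddle ℓ → (F : Frame ℓ) (p : P) →
  F ⊨ᶠ symAxiom p → Symmetric (Frame.R F)
symAxiom⇒symmetric em F p valid {s} {t} sRt = decidable-stable em λ ¬tRs →
  let t≢s : t ≢ s
      t≢s = λ { refl → ¬tRs sRt }
  in valid (λ _ u → u ≢ s) s
    ( (λ s≢s → s≢s refl)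
    -- ¬ (p ∧ ▲ p) holds at s, so ▲ would force it at t. But p ∧ ▲ p holds at t: both t and all its
    -- successors differ from s.
    , λ (preserved , _) → preserved (λ (s≢s , _) → s≢s refl) t sRt
        ( t≢s
        , (λ { _ u tRu refl → ¬tRs tRu })
        , (λ ¬t≢s → contradiction t≢s ¬t≢s)
        )
    )

proposition20 : ∀ {ℓ} → ExcludedMiddle ℓ → (P : Set ℓ) → P →
    Σ[ Γ ∈ Pred (Formula P) ℓ ] (∀ (F : Frame ℓ) → Symmetric (Frame.R F) ⇔ (F ⊨ˢ Γ))
proposition20 em P p = (_≡ symAxiom p) , λ F → mk⇔ {A = Symmetric (Frame.R F)}
  (λ { R-sym _ refl → symmetric⇒symAxiom F p (λ {x} {y} → R-sym {x} {y}) })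
  (λ valid → symAxiom⇒symmetric em F p (valid (symAxiom p) refl))
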